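{- In the state model with fractional permissions, let $A$ be an assertion and let $B$ be an intuitionistic assertion. Then: 1. If $B$ is combinable, then the combinable wand $A\mathbin{ -\!\!*}_c B$ is combinable. 2. $A\mathbin{ -\!\!*}_c B\models A\mathbin{ -\!\!*}B$. 3. If $A$ is a binary assertion, then $A\mathbin{ -\!\!*}_c B$ and $A\mathbin{ -\!\!*}B$ are equivalent (i.e. satisfied by exactly the same states).
   Context: **State model.** Let $L$ be a set of heap locations containing a special element $\mathit{null}$, and $V$ a set of values. A state is a pair $(\pi,h)$ of a permission mask $\pi:L\to\mathbb Q\cap[0,1]$ and a partial heap $h:L\rightharpoonup V$. It is valid iff $\pi(\mathit{null})=0$ and, for all $l\in L$, $\pi(l)>0$ implies that $h(l)$ is defined. $\Sigma$ is the set of valid states, and all states below range over $\Sigma$. The sum $(\pi_1,h_1)\oplus(\pi_2,h_2)$ is defined iff $h_1$ and $h_2$ agree wherever both are defined and $\pi_1(l)+\pi_2(l)\le1$ for all $l\in L$; then it equals $(\pi_1+\pi_2,h_1\cup h_2)$. Write $\sigma_1\#\sigma_2$ ("compatible") iff $\sigma_1\oplus\sigma_2$ is defined, and $\sigma_2\succeq\sigma_1$ iff $\sigma_2=\sigma_1\oplus\sigma_r$ for some $\sigma_r\in\Sigma$. **Scaling.** For a positive rational $\alpha$ and $(\pi,h)\in\Sigma$ with $\alpha\pi(l)\le1$ for all $l$, $\alpha\cdot(\pi,h):=(\lambda l.\,\alpha\pi(l),\,h)$. Define $\mathit{scaled}(\sigma):=\{\alpha\cdot\sigma\mid 0<\alpha\le1\}$.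 **Assertions.** An assertion is interpreted as a predicate on $\Sigma$; $\sigma\models A$ means that $A$ holds in $\sigma$, and $A\models B$ means that every state satisfying $A$ satisfies $B$. $\sigma\models A_1*A_2$ iff $\sigma=\sigma_1\oplus\sigma_2$ for some $\sigma_1\models A_1$, $\sigma_2\models A_2$. $A$ is intuitionistic iff $\sigma\models A$ and $\sigma'\succeq\sigma$ imply $\sigma'\models A$. For a fraction (rational) $0<p\le1$, the fractional assertion $A^p$ holds in $\sigma$ iff there is $\sigma_A\models A$ with $\sigma=p\cdot\sigma_A$. $A$ is combinable iff $A^p*A^q\models A^{p+q}$ for all positive fractions $p,q$ with $p+q\le1$. For a permission mask $\pi$, let $\mathit{bin}(\pi)(l)=1$ if $\pi(l)=1$ and $\mathit{bin}(\pi)(l)=0$ otherwise; $A$ is binary iff for every state $(\pi,h)\models A$ also $(\mathit{bin}(\pi),h)\models A$. **Standard wand.** $\sigma_w\models A\mathbin{ -\!\!*}B$ iff for all $\sigma_A$ with $\sigma_A\models A$ and $\sigma_A\#\sigma_w$, $\sigma_A\oplus\sigma_w\models B$. **Combinable wand.** For states $(\pi_A,h_A)$ and $(\pi_w,h_w)$, let $\pi_w'(l)=\min(\pi_w(l),1-\pi_A(l))$ for all $l$, and define $$\mathcal R((\pi_A,h_A),(\pi_w,h_w))=\begin{cases}(\pi_w,h_w)&\text{if for all }\sigma\in\mathit{scaled}((\pi_w,h_w)),\ \text{not }(\pi_A,h_A)\#\sigma,\\(\pi_w',h_w)&\text{otherwise.}\end{cases}$$ Then $\sigma_w\models A\mathbin{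 -\!\!*}_cB$ iff for all $\sigma_A$ with $\sigma_A\models A$ and $\sigma_A\#\mathcal R(\sigma_A,\sigma_w)$, $\sigma_A\oplus\mathcal R(\sigma_A,\sigma_w)\models B$. -}

module Defs where

open import Level using (Level; _⊔_)
open import Data.Bool.Base using (if_then_else_)
open import Data.Empty using (⊥-elim)
open import Data.Maybe using (Is-just)
open import Data.Maybe.Base using (Maybe; just; nothing; _<∣>_)
open import Data.Maybe.Relation.Unary.Any using (just)
open import Data.Product.Base using (Σ-syntax; ∃-syntax; _×_; _,_)
open import Data.Rational
  using (ℚ; 0ℚ; 1ℚ; _+_; _-_; _*_; -_; _⊓_; _≤_; _<_; _≟_; _<?_; nonNegative)
open import Data.Rational.Properties
open import Data.Unit.Base using (tt)
open import Relation.Binary.PropositionalEquality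
  using (_≡_; refl; sym; trans; cong; cong₂; subst)
open import Relation.Nullary using (¬_; Dec; yes; no; ⌊_⌋)
open import Relation.Unary using (Pred; _∈_; _⊆_)

private
  variable
    ℓ ℓ₁ ℓ₂ : Level

  p≤1⇒0≤1-p : ∀ {p} → p ≤ 1ℚ → 0ℚ ≤ 1ℚ - p
  p≤1⇒0≤1-p {p} p≤1 =
    subst (_≤ 1ℚ - p) (+-inverseʳ p) (+-monoˡ-≤ (- p) p≤1)

  0≤p*q : ∀ {p q} → 0ℚ < p → 0ℚ ≤ q → 0ℚ ≤ p * q
  0≤p*q {p} {q} 0<p 0≤q =
    subst (_≤ p * q) (*-zeroʳ p)
      (*-monoˡ-≤-nonNeg p {{nonNegative (<⇒≤ 0<p)}} 0≤q)

  0<p*q⇒0<q : ∀ {p q} → 0ℚ < p → 0ℚ < p * q → 0ℚ < q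
  0<p*q⇒0<q {p} {q} 0<p 0<pq =
    *-cancelˡ-<-nonNeg p {{nonNegative (<⇒≤ 0<p)}}
      (subst (_< p * q) (sym (*-zeroʳ p)) 0<pq)

  p*q≤1 : ∀ {p q} → p ≤ 1ℚ → 0ℚ ≤ q → q ≤ 1ℚ → p * q ≤ 1ℚ
  p*q≤1 {p} {q} p≤1 0≤q q≤1 =
    ≤-trans (*-monoʳ-≤-nonNeg q {{nonNegative 0≤q}} p≤1)
            (subst (_≤ 1ℚ) (sym (*-identityˡ q)) q≤1)

binℚ : ℚ → ℚ
binℚ q = if ⌊ q ≟ 1ℚ ⌋ then 1ℚ else 0ℚ

private
  0≤1 : 0ℚ ≤ 1ℚ
  0≤1 = <⇒≤ (positive⁻¹ 1ℚ)

  0≤bin : ∀ q → 0ℚ ≤ binℚ q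
  0≤bin q with q ≟ 1ℚ
  ... | yes _ = 0≤1
  ... | no  _ = ≤-refl

  bin≤1 : ∀ q → binℚ q ≤ 1ℚ
  bin≤1 q with q ≟ 1ℚ
  ... | yes _ = ≤-refl
  ... | no  _ = 0≤1

  0<bin⇒0< : ∀ q → 0ℚ < binℚ q → 0ℚ < q
  0<bin⇒0< q 0<b with q ≟ 1ℚ
  ... | yes refl = 0<b
  ... | no  _    = ⊥-elim (<-irrefl refl 0<b)

module StateModel {a b : Level} (L : Set a) (null : L) (V : Set b) where

  record State : Set (a ⊔ b) where
    field
      mask       : L → ℚ
      heap       : L → Maybe V
      0≤mask     : ∀ l → 0ℚ ≤ mask l
      mask≤1     : ∀ l → mask l ≤ 1ℚ
      mask-null  : mask null ≡ 0ℚ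
      0<mask⇒def : ∀ l → 0ℚ < mask l → Is-just (heap l)

  open State public

  -- Equality of the underlying pairs of functions.  There is no function
  -- extensionality, so this takes the place of _≡_ throughout.
  infix 4 _≈_
  record _≈_ (σ τ : State) : Set (a ⊔ b) where
    field
      mask-≡ : ∀ l → mask σ l ≡ mask τ l
      heap-≡ : ∀ l → heap σ l ≡ heap τ l

  infix 4 _#_
  record _#_ (σ τ : State) : Set (a ⊔ b) where
    field
      agree   : ∀ l {v w} → heap σ l ≡ just v → heap τ l ≡ just w → v ≡ w
      bounded : ∀ l → mask σ l + mask τ l ≤ 1ℚ

  open _#_ public

  -- The choice made by _<∣>_ is immaterial, since the heaps agree.
  add : (σ τ : State) → σ # τ → State
  add σ τ c = record
    { mask       = λ l → mask σ l + mask τ l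
    ; heap       = λ l → heap σ l <∣> heap τ l
    ; 0≤mask     = λ l → +-mono-≤ (0≤mask σ l) (0≤mask τ l)
    ; mask≤1     = bounded c
    ; mask-null  = cong₂ _+_ (mask-null σ) (mask-null τ)
    ; 0<mask⇒def = λ l → def (0<mask⇒def σ l) (0<mask⇒def τ l)
    }
    where
    def : ∀ {p q} {x y : Maybe V} →
          (0ℚ < p → Is-just x) → (0ℚ < q → Is-just y) →
          0ℚ < p + q → Is-just (x <∣> y)
    def {x = just _} f g 0<p+q = just tt
    def {p} {q} {x = nothing} f g 0<p+q with 0ℚ <? p
    ... | yes 0<p with () ← f 0<p
    ... | no  0≮p = g (<-≤-trans 0<p+q
            (subst (p + q ≤_) (+-identityˡ q) (+-monoˡ-≤ q (≮⇒≥ 0≮p))))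

  -- "The sum on the right is defined and equals the left-hand side."
  infix 4 _≃_⊕_
  _≃_⊕_ : State → State → State → Set (a ⊔ b)
  σ ≃ σ₁ ⊕ σ₂ = Σ[ c ∈ σ₁ # σ₂ ] σ ≈ add σ₁ σ₂ c

  infix 4 _⪰_
  _⪰_ : State → State → Set (a ⊔ b)
  σ₂ ⪰ σ₁ = ∃[ σᵣ ] σ₂ ≃ σ₁ ⊕ σᵣ

  record Scalable (α : ℚ) (σ : State) : Set a where
    field
      0<α   : 0ℚ < α
      α*π≤1 : ∀ l → α * mask σ l ≤ 1ℚ

  scale : (α : ℚ) (σ : State) → Scalable α σ → State
  scale α σ s = record
    { mask       = λ l → α * mask σ l
    ; heap       = heap σ
    ; 0≤mask     = λ l → 0≤p*q 0<α (0≤mask σ l)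
    ; mask≤1     = α*π≤1
    ; mask-null  = trans (cong (α *_) (mask-null σ)) (*-zeroʳ α)
    ; 0<mask⇒def = λ l 0<απ → 0<mask⇒def σ l (0<p*q⇒0<q 0<α 0<απ)
    }
    where open Scalable s

  ≤1⇒scalable : ∀ {α} σ → 0ℚ < α → α ≤ 1ℚ → Scalable α σ
  ≤1⇒scalable σ 0<α α≤1 = record
    { 0<α   = 0<α
    ; α*π≤1 = λ l → p*q≤1 α≤1 (0≤mask σ l) (mask≤1 σ l)
    }

  scaled : State → Pred State (a ⊔ b)
  scaled σ τ = ∃[ α ] Σ[ 0<α ∈ 0ℚ < α ] Σ[ α≤1 ∈ α ≤ 1ℚ ]
    τ ≈ scale α σ (≤1⇒scalable σ 0<α α≤1)

  infixr 7 _⋆_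
  _⋆_ : Pred State ℓ₁ → Pred State ℓ₂ → Pred State (a ⊔ b ⊔ ℓ₁ ⊔ ℓ₂)
  (A₁ ⋆ A₂) σ = ∃[ σ₁ ] ∃[ σ₂ ] σ₁ ∈ A₁ × σ₂ ∈ A₂ × σ ≃ σ₁ ⊕ σ₂

  Intuitionistic : Pred State ℓ → Set (a ⊔ b ⊔ ℓ)
  Intuitionistic A = ∀ {σ σ′} → σ ∈ A → σ′ ⪰ σ → σ′ ∈ A

  -- Meant for fractions 0 < p ≤ 1.
  infixl 8 _^_
  _^_ : Pred State ℓ → ℚ → Pred State (a ⊔ b ⊔ ℓ)
  (A ^ p) σ = ∃[ σA ] σA ∈ A × (Σ[ s ∈ Scalable p σA ] σ ≈ scale p σA s)

  Combinable : Pred State ℓ → Set (a ⊔ b ⊔ ℓ)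
  Combinable A = ∀ p q → 0ℚ < p → 0ℚ < q → p + q ≤ 1ℚ →
    (A ^ p) ⋆ (A ^ q) ⊆ A ^ (p + q)

  bin : State → State
  bin σ = record
    { mask       = λ l → binℚ (mask σ l)
    ; heap       = heap σ
    ; 0≤mask     = λ l → 0≤bin (mask σ l)
    ; mask≤1     = λ l → bin≤1 (mask σ l)
    ; mask-null  = cong binℚ (mask-null σ)
    ; 0<mask⇒def = λ l 0<b → 0<mask⇒def σ l (0<bin⇒0< (mask σ l) 0<b)
    }

  Binary : Pred State ℓ → Set (a ⊔ b ⊔ ℓ)
  Binary A = ∀ σ → σ ∈ A → bin σ ∈ A

  infixr 6 _-⋆_ _-⋆ᶜ_
  _-⋆_ : Pred State ℓ₁ → Pred State ℓ₂ → Pred State (a ⊔ b ⊔ ℓ₁ ⊔ ℓ₂)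
  (A -⋆ B) σw = ∀ σA → σA ∈ A → (c : σA # σw) → add σA σw c ∈ B

  truncate : State → State → State
  truncate σA σw = record
    { mask       = λ l → mask σw l ⊓ (1ℚ - mask σA l)
    ; heap       = heap σw
    ; 0≤mask     = λ l → ⊓-glb (0≤mask σw l) (p≤1⇒0≤1-p (mask≤1 σA l))
    ; mask≤1     = λ l → ≤-trans (p⊓q≤p _ _) (mask≤1 σw l)
    ; mask-null  = cong₂ (λ p q → p ⊓ (1ℚ - q)) (mask-null σw) (mask-null σA)
    ; 0<mask⇒def = λ l 0<m → 0<mask⇒def σw l (<-≤-trans 0<m (p⊓q≤p _ _))
    }

  NeverCompatible : State → State → Set (a ⊔ b)
  NeverCompatible σA σw = ∀ σ → σ ∈ scaled σw → ¬ (σA # σ)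

  -- NeverCompatible is undecidable in general, so the case distinction is on
  -- an explicit decision.  By ℛ-unique the result does not depend on which
  -- one, and under excluded middle there always is one.
  ℛ : (σA σw : State) → Dec (NeverCompatible σA σw) → State
  ℛ σA σw (yes _) = σw
  ℛ σA σw (no  _) = truncate σA σw

  ℛ-unique : ∀ σA σw d d′ → ℛ σA σw d ≈ ℛ σA σw d′
  ℛ-unique σA σw (yes _) (yes _) = record { mask-≡ = λ _ → refl ; heap-≡ = λ _ → refl }
  ℛ-unique σA σw (no  _) (no  _) = record { mask-≡ = λ _ → refl ; heap-≡ = λ _ → refl }
  ℛ-unique σA σw (yes p) (no ¬p) = ⊥-elim (¬p p)
  ℛ-unique σA σw (no ¬p) (yes p) = ⊥-elim (¬p p)

  _-⋆ᶜ_ : Pred State ℓ₁ → Pred State ℓ₂ → Pred State (a ⊔ b ⊔ ℓ₁ ⊔ ℓ₂)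
  (A -⋆ᶜ B) σw = ∀ σA → σA ∈ A → (d : Dec (NeverCompatible σA σw)) →
    (c : σA # ℛ σA σw d) → add σA (ℛ σA σw d) c ∈ B

{-# OPTIONS --safe #-}

-- All three parts compare two states of B: since B is intuitionistic it
-- suffices to exhibit a state of B that is pointwise below the goal (_⊑_).
--
-- Part 1: for σ = p σ₁ ⊕ q σ₂, the witness is ω = σ / (p + q).  If ω has a
-- scaling compatible with σA, then so do σ₁ and σ₂, so both wands are used in
-- their truncated form.  As x ↦ a + min(x, 1 - a) = min(a + x, 1) is concave,
-- the weighted mean of the two resulting states of B lies below the goal.
--
-- Part 3: if some scaling of σw is compatible with σA, then σw is zero
-- wherever σA has full permission, so bin σA # σw, and their sum lies below
-- σA ⊕ truncate σA σw.

module Submission where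

open import Defs
open import Level using (Level; _⊔_)
open import Algebra.Bundles using (CommutativeMonoid)
import Algebra.Properties.CommutativeSemigroup as CommutativeSemigroupProperties
open import Data.Maybe.Base using (Maybe; just; nothing; _<∣>_)
open import Data.Product.Base using (∃-syntax; _×_; _,_)
open import Data.Rational
  using (ℚ; 0ℚ; 1ℚ; _+_; _-_; _*_; -_; _⊓_; 1/_; _≤_; _<_; _≟_;
         Positive; positive; nonNegative)
open import Data.Rational.Properties
open import Function.Base using (_∘_)
open import Relation.Binary.PropositionalEquality
  using (_≡_; refl; sym; trans; cong; cong₂; subst; module ≡-Reasoning)
open import Relation.Nullary using (¬_; yes; no; contradiction)
open import Relation.Unary using (Pred; _∈_; _⊆_; _≐_)

open CommutativeSemigroupProperties
  (CommutativeMonoid.commutativeSemigroup +-0-commutativeMonoid) using (interchange)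

-- Arithmetic of rational permissions.

p+[q-p]≡q : ∀ p q → p + (q - p) ≡ q
p+[q-p]≡q p q = trans (+-comm p (q - p))
  (trans (+-assoc q (- p) p)
    (trans (cong (q +_) (+-inverseˡ p)) (+-identityʳ q)))

p≤q⇒0≤q-p : ∀ {p q} → p ≤ q → 0ℚ ≤ q - p
p≤q⇒0≤q-p {p} {q} p≤q = subst (_≤ q - p) (+-inverseʳ p) (+-monoˡ-≤ (- p) p≤q)

p≤p+q : ∀ p {q} → 0ℚ ≤ q → p ≤ p + q
p≤p+q p {q} 0≤q = subst (_≤ p + q) (+-identityʳ p) (+-monoʳ-≤ p 0≤q)

p≤q+p : ∀ p {q} → 0ℚ ≤ q → p ≤ q + p
p≤q+p p {q} 0≤q = subst (p ≤_) (+-comm p q) (p≤p+q p 0≤q)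

p-q≤p : ∀ p {q} → 0ℚ ≤ q → p - q ≤ p
p-q≤p p {q} 0≤q =
  subst (p - q ≤_) (+-identityʳ p) (+-monoʳ-≤ p (neg-antimono-≤ 0≤q))

*-monoˡ-≤ : ∀ {p q r} → 0ℚ < p → q ≤ r → p * q ≤ p * r
*-monoˡ-≤ {p} 0<p = *-monoˡ-≤-nonNeg p {{nonNegative (<⇒≤ 0<p)}}

0<p*q : ∀ {p q} → 0ℚ < p → 0ℚ < q → 0ℚ < p * q
0<p*q {p} {q} 0<p 0<q =
  positive⁻¹ (p * q) {{pos*pos⇒pos p {{positive 0<p}} q {{positive 0<q}}}}

p*q≤p : ∀ {p q} → 0ℚ < p → q ≤ 1ℚ → p * q ≤ p
p*q≤p {p} {q} 0<p q≤1 =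
  subst (p * q ≤_) (*-identityʳ p) (*-monoˡ-≤ 0<p q≤1)

reciprocal : ∀ {p} → 0ℚ < p → ∃[ r ] 0ℚ < r × p * r ≡ 1ℚ
reciprocal {p} 0<p = 1/ p , positive⁻¹ (1/ p) {{1/pos⇒pos p}} , *-inverseʳ p
  where instance
    _ : Positive p
    _ = positive 0<p
    _ = pos⇒nonZero p

-- Rewrites a truncated permission added to `a` as a sum capped at 1, the form in which both the
-- concavity and the bound by 1 can be read off.
a+x⊓[1-a]≡[a+x]⊓1 : ∀ a x → a + x ⊓ (1ℚ - a) ≡ (a + x) ⊓ 1ℚ
a+x⊓[1-a]≡[a+x]⊓1 a x =
  trans (mono-≤-distrib-⊓ (+-monoʳ-≤ a) x (1ℚ - a))
        (cong ((a + x) ⊓_) (p+[q-p]≡q a 1ℚ))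

-- Once every term is a capped sum, the factor `s` moves inside the minimum on the right, so it
-- suffices to bound the left side by each argument: by linearity for the sum, and by `p + q` for
-- the cap.
truncated-mean : ∀ {p q s} a x y z → 0ℚ < p → 0ℚ < q → p + q ≡ s →
  p * x + q * y ≡ s * z →
  p * (a + x ⊓ (1ℚ - a)) + q * (a + y ⊓ (1ℚ - a)) ≤ s * (a + z ⊓ (1ℚ - a))
truncated-mean {p} {q} {s} a x y z 0<p 0<q refl mean
  rewrite a+x⊓[1-a]≡[a+x]⊓1 a x | a+x⊓[1-a]≡[a+x]⊓1 a y | a+x⊓[1-a]≡[a+x]⊓1 a z
        | *-distribˡ-⊓-nonNeg s {{nonNegative (<⇒≤ (+-mono-< 0<p 0<q))}} (a + z) 1ℚ
  = ⊓-glb below-sum below-one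
  where
  regroup : p * (a + x) + q * (a + y) ≡ s * (a + z)
  regroup = begin
    p * (a + x) + q * (a + y)             ≡⟨ cong₂ _+_ (*-distribˡ-+ p a x) (*-distribˡ-+ q a y) ⟩
    (p * a + p * x) + (q * a + q * y)     ≡⟨ interchange (p * a) (p * x) (q * a) (q * y) ⟩
    (p * a + q * a) + (p * x + q * y)     ≡⟨ cong₂ _+_ (sym (*-distribʳ-+ a p q)) mean ⟩
    s * a + s * z                         ≡⟨ *-distribˡ-+ s a z ⟨
    s * (a + z)                           ∎
    where open ≡-Reasoning

  below-sum : p * ((a + x) ⊓ 1ℚ) + q * ((a + y) ⊓ 1ℚ) ≤ s * (a + z)
  below-sum = ≤-trans
    (+-mono-≤ (*-monoˡ-≤ 0<p (p⊓q≤p (a + x) 1ℚ)) (*-monoˡ-≤ 0<q (p⊓q≤p (a + y) 1ℚ)))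
    (≤-reflexive regroup)

  below-one : p * ((a + x) ⊓ 1ℚ) + q * ((a + y) ⊓ 1ℚ) ≤ s * 1ℚ
  below-one = ≤-trans
    (+-mono-≤ (*-monoˡ-≤ 0<p (p⊓q≤q (a + x) 1ℚ)) (*-monoˡ-≤ 0<q (p⊓q≤q (a + y) 1ℚ)))
    (≤-reflexive (sym (*-distribʳ-+ 1ℚ p q)))

-- At full permission `binℚ a` is `a` itself and `x` adds nothing; elsewhere `binℚ a` is 0, which
-- leaves only `x`.
bin+≤truncated : ∀ a x → 0ℚ ≤ a → (a ≡ 1ℚ → x ≤ 0ℚ) → x ≤ 1ℚ →
  binℚ a + x ≤ (a + x) ⊓ 1ℚ
bin+≤truncated a x 0≤a full⇒x≤0 x≤1 with a ≟ 1ℚ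
... | yes refl = ⊓-glb ≤-refl (+-monoʳ-≤ 1ℚ (full⇒x≤0 refl))
... | no  _    = ⊓-glb (+-monoˡ-≤ x 0≤a) (subst (_≤ 1ℚ) (sym (+-identityˡ x)) x≤1)

-- Order and union of partial values at a single location.

module _ {b} {V : Set b} where

  infix 4 _≼_
  -- The flat information order, with `nothing` at the bottom.
  _≼_ : Maybe V → Maybe V → Set b
  x ≼ y = ∀ {v} → x ≡ just v → y ≡ just v

  Agree : Maybe V → Maybe V → Set b
  Agree x y = ∀ {v w} → x ≡ just v → y ≡ just w → v ≡ w

  ≼-refl : ∀ {x} → x ≼ x
  ≼-refl eq = eq

  ≼-reflexive : ∀ {x y} → x ≡ y → x ≼ y
  ≼-reflexive refl eq = eq

  ≼-trans : ∀ {x y z} → x ≼ y → y ≼ z → x ≼ z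
  ≼-trans x≼y y≼z eq = y≼z (x≼y eq)

  x≼x<∣>y : ∀ x y → x ≼ (x <∣> y)
  x≼x<∣>y (just _) y eq = eq

  -- The union prefers its left argument, so the right one survives only under agreement.
  y≼x<∣>y : ∀ x y → Agree x y → y ≼ (x <∣> y)
  y≼x<∣>y nothing  y agr eq = eq
  y≼x<∣>y (just _) y agr eq = cong just (agr refl eq)

  <∣>-lub : ∀ x y {z} → x ≼ z → y ≼ z → (x <∣> y) ≼ z
  <∣>-lub nothing  y x≼z y≼z eq = y≼z eq
  <∣>-lub (just _) y x≼z y≼z eq = x≼z eq

  ≼⇒<∣>≡ : ∀ x y → x ≼ y → y ≡ (x <∣> y)
  ≼⇒<∣>≡ nothing  y x≼y = refl
  ≼⇒<∣>≡ (just _) y x≼y = x≼y refl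

  ≼-agree : ∀ {x y z} → x ≼ z → y ≼ z → Agree x y
  ≼-agree x≼z y≼z eq eq′ with refl ← trans (sym (x≼z eq)) (y≼z eq′) = refl

module StateProperties {a b : Level} (L : Set a) (null : L) (V : Set b) where

  open StateModel L null V

  -- The pointwise order on states.

  infix 4 _⊑_
  record _⊑_ (σ τ : State) : Set (a ⊔ b) where
    field
      mask-≤ : ∀ l → mask σ l ≤ mask τ l
      heap-≼ : ∀ l → heap σ l ≼ heap τ l
  open _⊑_

  ⊑-trans : ∀ {σ τ υ} → σ ⊑ τ → τ ⊑ υ → σ ⊑ υ
  ⊑-trans σ⊑τ τ⊑υ = record
    { mask-≤ = λ l → ≤-trans (mask-≤ σ⊑τ l) (mask-≤ τ⊑υ l)
    ; heap-≼ = λ l eq → heap-≼ τ⊑υ l (heap-≼ σ⊑τ l eq)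
    }

  ≈⇒⊒ : ∀ {σ τ} → σ ≈ τ → τ ⊑ σ
  ≈⇒⊒ σ≈τ = record
    { mask-≤ = λ l → ≤-reflexive (sym (mask-≡ l))
    ; heap-≼ = λ l → ≼-reflexive (sym (heap-≡ l))
    }
    where open _≈_ σ≈τ

  -- The remainder carries the difference of the masks and the entire heap of `τ`: heaps may overlap
  -- where they agree, and every location with leftover permission is then defined.
  ⊑⇒⪰ : ∀ {σ τ} → σ ⊑ τ → τ ⪰ σ
  ⊑⇒⪰ {σ} {τ} σ⊑τ = difference , compatible , record
    { mask-≡ = λ l → sym (p+[q-p]≡q (mask σ l) (mask τ l))
    ; heap-≡ = λ l → ≼⇒<∣>≡ (heap σ l) (heap τ l) (heap-≼ σ⊑τ l)
    }
    where
    difference : State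
    difference = record
      { mask       = λ l → mask τ l - mask σ l
      ; heap       = heap τ
      ; 0≤mask     = λ l → p≤q⇒0≤q-p (mask-≤ σ⊑τ l)
      ; mask≤1     = λ l → ≤-trans (p-q≤p (mask τ l) (0≤mask σ l)) (mask≤1 τ l)
      ; mask-null  = cong₂ _-_ (mask-null τ) (mask-null σ)
      ; 0<mask⇒def = λ l 0<d →
          0<mask⇒def τ l (<-≤-trans 0<d (p-q≤p (mask τ l) (0≤mask σ l)))
      }

    compatible : σ # difference
    compatible = record
      { agree   = λ l → ≼-agree {z = heap τ l} (heap-≼ σ⊑τ l) ≼-refl
      ; bounded = λ l →
          subst (_≤ 1ℚ) (sym (p+[q-p]≡q (mask σ l) (mask τ l))) (mask≤1 τ l)
      }

  #-antitoneʳ : ∀ {σ τ υ} → τ ⊑ υ → σ # υ → σ # τ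
  #-antitoneʳ {σ} τ⊑υ σ#υ = record
    { agree   = λ l eq eq′ → agree σ#υ l eq (heap-≼ τ⊑υ l eq′)
    ; bounded = λ l → ≤-trans (+-monoʳ-≤ (mask σ l) (mask-≤ τ⊑υ l)) (bounded σ#υ l)
    }

  summandˡ-⊑ : ∀ {σ σ₁ σ₂} → σ ≃ σ₁ ⊕ σ₂ → σ₁ ⊑ σ
  summandˡ-⊑ {σ} {σ₁} {σ₂} (c , σ≈) = ⊑-trans {τ = add σ₁ σ₂ c} (record
    { mask-≤ = λ l → p≤p+q (mask σ₁ l) (0≤mask σ₂ l)
    ; heap-≼ = λ l → x≼x<∣>y (heap σ₁ l) (heap σ₂ l)
    }) (≈⇒⊒ σ≈)

  summandʳ-⊑ : ∀ {σ σ₁ σ₂} → σ ≃ σ₁ ⊕ σ₂ → σ₂ ⊑ σ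
  summandʳ-⊑ {σ} {σ₁} {σ₂} (c , σ≈) = ⊑-trans {τ = add σ₁ σ₂ c} (record
    { mask-≤ = λ l → p≤q+p (mask σ₂ l) (0≤mask σ₁ l)
    ; heap-≼ = λ l → y≼x<∣>y (heap σ₁ l) (heap σ₂ l) (agree c l)
    }) (≈⇒⊒ σ≈)

  -- Compatibility with scalings, and truncation.

  #⇒¬NeverCompatible : ∀ {σA σw} → σA # σw → ¬ NeverCompatible σA σw
  #⇒¬NeverCompatible {σA} {σw} c never =
    -- The factor 1 makes `σw` one of its own scalings.
    never σw (1ℚ , positive⁻¹ 1ℚ , ≤-refl , record
      { mask-≡ = λ l → sym (*-identityˡ (mask σw l))
      ; heap-≡ = λ _ → refl
      }) c

  -- If `α` times `τ` were compatible with `σA`, so would be the smaller state `α * β` times `σ`,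
  -- which is again a scaling of `σ` by a factor at most 1.
  NeverCompatible-scale : ∀ {σA σ β} τ (s : Scalable β σ) → β ≤ 1ℚ →
    scale β σ s ⊑ τ → NeverCompatible σA σ → NeverCompatible σA τ
  NeverCompatible-scale {σA} {σ} {β} τ s β≤1 βσ⊑τ never υ (α , 0<α , α≤1 , υ≈) σA#υ =
    never αβσ (α * β , 0<αβ , αβ≤1 , record { mask-≡ = λ _ → refl ; heap-≡ = λ _ → refl })
      (#-antitoneʳ (⊑-trans αβσ⊑ατ (≈⇒⊒ υ≈)) σA#υ)
    where
    0<αβ : 0ℚ < α * β
    0<αβ = 0<p*q 0<α (Scalable.0<α s)

    αβ≤1 : α * β ≤ 1ℚ
    αβ≤1 = ≤-trans (p*q≤p 0<α β≤1) α≤1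

    αβσ : State
    αβσ = scale (α * β) σ (≤1⇒scalable σ 0<αβ αβ≤1)

    αβσ⊑ατ : αβσ ⊑ scale α τ (≤1⇒scalable τ 0<α α≤1)
    αβσ⊑ατ = record
      { mask-≤ = λ l → subst (_≤ α * mask τ l) (sym (*-assoc α β (mask σ l)))
                         (*-monoˡ-≤ 0<α (mask-≤ βσ⊑τ l))
      ; heap-≼ = heap-≼ βσ⊑τ
      }

  ¬NeverCompatible⇒zero-at-full : ∀ σA σw → ¬ NeverCompatible σA σw →
    ∀ l → mask σA l ≡ 1ℚ → mask σw l ≤ 0ℚ
  ¬NeverCompatible⇒zero-at-full σA σw ¬never l full = ≮⇒≥ λ 0<w →
    ¬never λ υ (α , 0<α , _ , υ≈) σA#υ →
      <-irrefl refl (<-≤-trans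
        (subst (1ℚ <_) (cong₂ _+_ (sym full) (sym (_≈_.mask-≡ υ≈ l)))
          (subst (_< 1ℚ + α * mask σw l) (+-identityʳ 1ℚ)
            (+-monoʳ-< 1ℚ (0<p*q 0<α 0<w))))
        (bounded σA#υ l))

  truncate-# : ∀ σA σw → (∀ l → Agree (heap σA l) (heap σw l)) →
    σA # truncate σA σw
  truncate-# σA σw agr = record
    { agree   = agr
    ; bounded = λ l → subst (_≤ 1ℚ)
        (sym (a+x⊓[1-a]≡[a+x]⊓1 (mask σA l) (mask σw l)))
        (p⊓q≤q (mask σA l + mask σw l) 1ℚ)
    }

  -- The three claims about the combinable wand.

  module _ {ℓ₁ ℓ₂} (A : Pred State ℓ₁) (B : Pred State ℓ₂)
           (intuitionistic : Intuitionistic B) where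

    upward : ∀ {σ τ} → σ ⊑ τ → σ ∈ B → τ ∈ B
    upward σ⊑τ σ∈B = intuitionistic σ∈B (⊑⇒⪰ σ⊑τ)

    -⋆ᶜ-combinable : Combinable B → Combinable (A -⋆ᶜ B)
    -⋆ᶜ-combinable combinable p q 0<p 0<q p+q≤1 {σ}
      (σ₁′ , σ₂′ , (σ₁ , σ₁∈W , s₁ , σ₁′≈) , (σ₂ , σ₂∈W , s₂ , σ₂′≈) , sum@(c₁₂ , σ≈))
      with r , 0<r , sr≡1 ← reciprocal (+-mono-< 0<p 0<q)
      = ω , ω∈W , ω-scalable , record { mask-≡ = σ≡sω ; heap-≡ = λ _ → refl }
      where
      s : ℚ
      s = p + q

      0<s : 0ℚ < s
      0<s = +-mono-< 0<p 0<q

      pσ₁⊑σ : scale p σ₁ s₁ ⊑ σ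
      pσ₁⊑σ = ⊑-trans (≈⇒⊒ σ₁′≈) (summandˡ-⊑ sum)

      qσ₂⊑σ : scale q σ₂ s₂ ⊑ σ
      qσ₂⊑σ = ⊑-trans (≈⇒⊒ σ₂′≈) (summandʳ-⊑ sum)

      σ≡pσ₁+qσ₂ : ∀ l → mask σ l ≡ p * mask σ₁ l + q * mask σ₂ l
      σ≡pσ₁+qσ₂ l = trans (_≈_.mask-≡ σ≈ l)
        (cong₂ _+_ (_≈_.mask-≡ σ₁′≈ l) (_≈_.mask-≡ σ₂′≈ l))

      -- Makes division of `σ` by `s` legitimate: the scaled masks stay within 1.
      σ≤s : ∀ l → mask σ l ≤ s
      σ≤s l = subst (_≤ s) (sym (σ≡pσ₁+qσ₂ l))
        (+-mono-≤ (p*q≤p 0<p (mask≤1 σ₁ l)) (p*q≤p 0<q (mask≤1 σ₂ l)))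

      r-scalable : Scalable r σ
      r-scalable = record
        { 0<α   = 0<r
        ; α*π≤1 = λ l → subst (r * mask σ l ≤_) (trans (*-comm r s) sr≡1)
                          (*-monoˡ-≤ 0<r (σ≤s l))
        }

      ω : State
      ω = scale r σ r-scalable

      σ≡sω : ∀ l → mask σ l ≡ s * mask ω l
      σ≡sω l = sym (trans (sym (*-assoc s r (mask σ l)))
        (trans (cong (_* mask σ l) sr≡1) (*-identityˡ (mask σ l))))

      ω-scalable : Scalable s ω
      ω-scalable = record
        { 0<α   = 0<s
        ; α*π≤1 = λ l → subst (_≤ 1ℚ) (σ≡sω l) (mask≤1 σ l)
        }

      -- Dividing by `s` places `r * t` times `τ` below `ω`. The contrapositive puts both component
      -- wands in their truncated case.
      NeverCompatible-part : ∀ {σA t τ} (st : Scalable t τ) → t ≤ s →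
        scale t τ st ⊑ σ → NeverCompatible σA τ → NeverCompatible σA ω
      NeverCompatible-part {t = t} {τ} st t≤s tτ⊑σ =
        NeverCompatible-scale ω (≤1⇒scalable τ 0<rt rt≤1) rt≤1 (record
          { mask-≤ = λ l → subst (_≤ mask ω l) (sym (*-assoc r t (mask τ l)))
                             (*-monoˡ-≤ 0<r (mask-≤ tτ⊑σ l))
          ; heap-≼ = heap-≼ tτ⊑σ
          })
        where
        0<rt : 0ℚ < r * t
        0<rt = 0<p*q 0<r (Scalable.0<α st)

        rt≤1 : r * t ≤ 1ℚ
        rt≤1 = subst (r * t ≤_) (trans (*-comm r s) sr≡1) (*-monoˡ-≤ 0<r t≤s)

      p≤s : p ≤ s
      p≤s = p≤p+q p (<⇒≤ 0<q)

      q≤s : q ≤ s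
      q≤s = p≤q+p q (<⇒≤ 0<p)

      ω∈W : ω ∈ (A -⋆ᶜ B)
      -- Here `c` relates `σA` to `ω` itself, so the case is vacuous.
      ω∈W σA σA∈A (yes never) c = contradiction never (#⇒¬NeverCompatible c)
      ω∈W σA σA∈A (no ¬never) c =
        let σB , σB∈B , _ , mean≈sσB = combinable p q 0<p 0<q p+q≤1
              ( scale p τ₁ pτ₁ , scale q τ₂ qτ₂
              , (τ₁ , τ₁∈B , pτ₁ , ≈-refl) , (τ₂ , τ₂∈B , qτ₂ , ≈-refl)
              , c′ , ≈-refl )
        in upward (record
             -- Combinability describes `σB` only through `s` times its mask, so the comparison with
             -- `goal` is made after multiplying by `s`.
             { mask-≤ = λ l → *-cancelˡ-≤-pos s {{positive 0<s}}
                 (subst (_≤ s * mask goal l) (_≈_.mask-≡ mean≈sσB l) (mean≤ l))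
             ; heap-≼ = λ l eq → <∣>-lub (heap τ₁ l) (heap τ₂ l) (τ₁≼goal l) (τ₂≼goal l)
                 (trans (_≈_.heap-≡ mean≈sσB l) eq)
             }) σB∈B
        where
        ≈-refl : ∀ {υ} → υ ≈ υ
        ≈-refl = record { mask-≡ = λ _ → refl ; heap-≡ = λ _ → refl }

        goal : State
        goal = add σA (truncate σA ω) c

        c₁ : σA # truncate σA σ₁
        c₁ = truncate-# σA σ₁ λ l eq eq′ → agree c l eq (heap-≼ pσ₁⊑σ l eq′)

        c₂ : σA # truncate σA σ₂
        c₂ = truncate-# σA σ₂ λ l eq eq′ → agree c l eq (heap-≼ qσ₂⊑σ l eq′)

        τ₁ τ₂ : State
        τ₁ = add σA (truncate σA σ₁) c₁
        τ₂ = add σA (truncate σA σ₂) c₂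

        τ₁∈B : τ₁ ∈ B
        τ₁∈B = σ₁∈W σA σA∈A (no (¬never ∘ NeverCompatible-part s₁ p≤s pσ₁⊑σ)) c₁

        τ₂∈B : τ₂ ∈ B
        τ₂∈B = σ₂∈W σA σA∈A (no (¬never ∘ NeverCompatible-part s₂ q≤s qσ₂⊑σ)) c₂

        pτ₁ : Scalable p τ₁
        pτ₁ = ≤1⇒scalable τ₁ 0<p (≤-trans p≤s p+q≤1)

        qτ₂ : Scalable q τ₂
        qτ₂ = ≤1⇒scalable τ₂ 0<q (≤-trans q≤s p+q≤1)

        heap-add-≼ : ∀ l {x} → x ≼ heap σ l → (heap σA l <∣> x) ≼ heap goal l
        heap-add-≼ l {x} x≼ = <∣>-lub (heap σA l) x
          (x≼x<∣>y (heap σA l) (heap σ l))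
          (≼-trans {y = heap σ l} x≼ (y≼x<∣>y (heap σA l) (heap σ l) (agree c l)))

        τ₁≼goal : ∀ l → heap τ₁ l ≼ heap goal l
        τ₁≼goal l = heap-add-≼ l (heap-≼ pσ₁⊑σ l)

        τ₂≼goal : ∀ l → heap τ₂ l ≼ heap goal l
        τ₂≼goal l = heap-add-≼ l (heap-≼ qσ₂⊑σ l)

        c′ : scale p τ₁ pτ₁ # scale q τ₂ qτ₂
        c′ = record
          { agree   = λ l → ≼-agree {z = heap goal l} (τ₁≼goal l) (τ₂≼goal l)
          ; bounded = λ l → ≤-trans
              (+-mono-≤ (p*q≤p 0<p (mask≤1 τ₁ l)) (p*q≤p 0<q (mask≤1 τ₂ l))) p+q≤1
          }

        mean≤ : ∀ l → p * mask τ₁ l + q * mask τ₂ l ≤ s * mask goal l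
        mean≤ l = truncated-mean
          (mask σA l) (mask σ₁ l) (mask σ₂ l) (mask ω l) 0<p 0<q refl
          (trans (sym (σ≡pσ₁+qσ₂ l)) (σ≡sω l))

    -- Compatibility selects the truncated case, and truncation only lowers permissions, so the
    -- resulting state of `B` lies below the goal.
    -⋆ᶜ⊆-⋆ : (A -⋆ᶜ B) ⊆ (A -⋆ B)
    -⋆ᶜ⊆-⋆ {σw} σw∈W σA σA∈A c = upward (record
        { mask-≤ = λ l → +-monoʳ-≤ (mask σA l) (p⊓q≤p (mask σw l) (1ℚ - mask σA l))
        ; heap-≼ = λ _ → ≼-refl
        }) (σw∈W σA σA∈A (no (#⇒¬NeverCompatible c)) (truncate-# σA σw (agree c)))

    -⋆⊆-⋆ᶜ : Binary A → (A -⋆ B) ⊆ (A -⋆ᶜ B)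
    -⋆⊆-⋆ᶜ binary {σw} σw∈W σA σA∈A (yes _) c = σw∈W σA σA∈A c
    -- The wand is applied to `bin σA`, which keeps the heap of `σA`. The single bound `bin+w≤`
    -- yields both its compatibility with `σw` and the comparison with the goal.
    -⋆⊆-⋆ᶜ binary {σw} σw∈W σA σA∈A (no ¬never) c = upward (record
        { mask-≤ = λ l → subst (mask (bin σA) l + mask σw l ≤_)
            (sym (a+x⊓[1-a]≡[a+x]⊓1 (mask σA l) (mask σw l))) (bin+w≤ l)
        ; heap-≼ = λ _ → ≼-refl
        }) (σw∈W (bin σA) (binary σA σA∈A) (record
        { agree   = agree c
        ; bounded = λ l → ≤-trans (bin+w≤ l) (p⊓q≤q (mask σA l + mask σw l) 1ℚ)
        }))
      where
      bin+w≤ : ∀ l → mask (bin σA) l + mask σw l ≤ (mask σA l + mask σw l) ⊓ 1ℚ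
      bin+w≤ l = bin+≤truncated (mask σA l) (mask σw l) (0≤mask σA l)
        (¬NeverCompatible⇒zero-at-full σA σw ¬never l) (mask≤1 σw l)

theorem3 : ∀ {a b ℓ₁ ℓ₂ : Level} (L : Set a) (null : L) (V : Set b) →
    let open StateModel L null V in
    (A : Pred State ℓ₁) (B : Pred State ℓ₂) →
    Intuitionistic B →
    (Combinable B → Combinable (A -⋆ᶜ B))
    × ((A -⋆ᶜ B) ⊆ (A -⋆ B))
    × (Binary A → (A -⋆ᶜ B) ≐ (A -⋆ B))
theorem3 L null V A B intuitionistic =
    -⋆ᶜ-combinable A B intuitionistic
  , -⋆ᶜ⊆-⋆ A B intuitionistic
  , λ binary → -⋆ᶜ⊆-⋆ A B intuitionistic , -⋆⊆-⋆ᶜ A B intuitionistic binary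
  where open StateProperties L null V
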